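{- Let $I$ and $C$ be disjoint finite sets of propositional variables and let $S$ be a set of explanations over hypotheses $I$ and manifestations $C$. Then $S$ satisfies consequential monotony if and only if there exists a default theory $\langle D,W\rangle$ supporting exactly $S$, i.e. such that for every $E\subseteq I$ and every nonempty $M\subseteq C$: $E\Rightarrow M\in S$ if and only if $\langle D,W\cup E\rangle$ has at least one consistent extension that entails $M$.
   Context: A set of variables is read as the set (conjunction) of the corresponding positive literals. An explanation over hypotheses $I$ and manifestations $C$ is a pair of sets $E\subseteq I$, $M\subseteq C$ with $M\neq\emptyset$, written $E\Rightarrow M$. A set $S$ of explanations satisfies consequential monotony if it contains $E\Rightarrow M'$ whenever it contains $E\Rightarrow M$, for every nonempty $M'\subseteq M$. A (Reiter) default theory is a pair $\langle D,W\rangle$ where $W$ is a propositional formula (or set of formulae) and $D$ is a set of rules (defaults) $\frac{A:B}{Q}$ with $A$ (prerequisite), $B$ (justification), $Q$ (consequent) propositional formulae. For a set of formulae $\Theta$, let $\Gamma(\Theta)$ be the smallest deductively closed set of formulae that contains $W$ and contains $Q$ whenever $\frac{A:B}{Q}\in D$, $A\in\Gamma(\Theta)$ and $\neg B\notin\Theta$. An extension of $\langle D,W\rangle$ is a set $\Theta$ with $\Theta=\Gamma(\Theta)$. An explanation $E\Rightarrow M$ is supported by $\langle D,W\rangle$ if $\langle D,W\cup E\rangle$ has at least one consistent extension where every element of $M$ holds. -}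

module Defs where

open import Data.Bool using (Bool; true; false; not; _∧_; _∨_)
open import Data.Fin using (Fin)
import Data.Fin.Subset as Sub
open import Data.Fin.Subset using (Subset; Nonempty)
open import Data.List using (List; []; _∷_)
open import Data.List.Relation.Unary.All using (All; []; _∷_)
open import Data.Nat using (ℕ)
open import Data.Product using (∃-syntax; _×_; _,_)
open import Function.Bundles using (_↣_; _⇔_; module Injection)
open import Level using (0ℓ)
open import Relation.Binary.PropositionalEquality using (_≡_; _≢_)
open import Relation.Nullary using (¬_)
open import Relation.Unary using (Pred; _∈_; _∉_; _⊆_; _≐_; _∪_)

infix  9 ~_
infixr 8 _∧ᶠ_
infixr 7 _∨ᶠ_
infixr 6 _→ᶠ_
infix  4 _⊨_ _⊢_

data Formula (V : Set) : Set where
  var            : V → Formula V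
  ⊥ᶠ ⊤ᶠ          : Formula V
  ~_             : Formula V → Formula V
  _∧ᶠ_ _∨ᶠ_ _→ᶠ_ : Formula V → Formula V → Formula V

eval : ∀ {V} → (V → Bool) → Formula V → Bool
eval v (var p)  = v p
eval v ⊥ᶠ       = false
eval v ⊤ᶠ       = true
eval v (~ φ)    = not (eval v φ)
eval v (φ ∧ᶠ ψ) = eval v φ ∧ eval v ψ
eval v (φ ∨ᶠ ψ) = eval v φ ∨ eval v ψ
eval v (φ →ᶠ ψ) = not (eval v φ) ∨ eval v ψ

_⊨_ : ∀ {V} → List (Formula V) → Formula V → Set
Φ ⊨ φ = ∀ v → All (λ ψ → eval v ψ ≡ true) Φ → eval v φ ≡ true

-- Entailment from a possibly infinite set of formulae, as classical
-- consequence of finitely many of its members.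
_⊢_ : ∀ {V} → Pred (Formula V) 0ℓ → Formula V → Set
T ⊢ φ = ∃[ Φ ] (All T Φ × Φ ⊨ φ)

DeductivelyClosed : ∀ {V} → Pred (Formula V) 0ℓ → Set
DeductivelyClosed T = ∀ {φ} → T ⊢ φ → φ ∈ T

Consistent : ∀ {V} → Pred (Formula V) 0ℓ → Set
Consistent T = ¬ (T ⊢ ⊥ᶠ)

record Default (V : Set) : Set where
  constructor _∶_/_
  field
    prerequisite  : Formula V
    justification : Formula V
    consequent    : Formula V

record DefaultTheory (V : Set) : Set₁ where
  constructor ⟨_,_⟩
  field
    D : Pred (Default V) 0ℓ
    W : Pred (Formula V) 0ℓ

module _ {V : Set} where

  record Closed (Δ : DefaultTheory V) (Θ T : Pred (Formula V) 0ℓ) : Set where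
    open DefaultTheory Δ
    field
      contains-W      : W ⊆ T
      deductive       : DeductivelyClosed T
      closed-defaults : ∀ {A B Q} → (A ∶ B / Q) ∈ D → A ∈ T → (~ B) ∉ Θ → Q ∈ T

  -- The smallest set T with Closed Δ Θ T; see Γ-closed and Γ-least.
  data Γ (Δ : DefaultTheory V) (Θ : Pred (Formula V) 0ℓ) : Pred (Formula V) 0ℓ where
    axiom  : ∀ {φ} → φ ∈ DefaultTheory.W Δ → Γ Δ Θ φ
    deduce : ∀ {φ} → Γ Δ Θ ⊢ φ → Γ Δ Θ φ
    apply  : ∀ {A B Q} → (A ∶ B / Q) ∈ DefaultTheory.D Δ →
             Γ Δ Θ A → (~ B) ∉ Θ → Γ Δ Θ Q

  Γ-closed : ∀ Δ Θ → Closed Δ Θ (Γ Δ Θ)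
  Γ-closed Δ Θ = record
    { contains-W = axiom ; deductive = deduce ; closed-defaults = apply }

  module _ {Δ : DefaultTheory V} {Θ T : Pred (Formula V) 0ℓ} (cl : Closed Δ Θ T) where
    open Closed cl

    Γ-least  : Γ Δ Θ ⊆ T
    Γ-least* : ∀ {Φ} → All (Γ Δ Θ) Φ → All T Φ

    Γ-least (axiom w)              = contains-W w
    Γ-least (deduce (Φ , ps , ⊨φ)) = deductive (Φ , Γ-least* ps , ⊨φ)
    Γ-least (apply d a ¬b)         = closed-defaults d (Γ-least a) ¬b

    Γ-least* []       = []
    Γ-least* (p ∷ ps) = Γ-least p ∷ Γ-least* ps

  Extension : DefaultTheory V → Pred (Formula V) 0ℓ → Set
  Extension Δ Θ = Θ ≐ Γ Δ Θ

-- A finite set of n variables is given by an injective enumeration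
-- Fin n ↣ V, and its subsets by Subset n.
literals : ∀ {V n} → Fin n ↣ V → Subset n → Pred (Formula V) 0ℓ
literals X P φ = ∃[ x ] (x Sub.∈ P × φ ≡ var (Injection.to X x))

Disjoint : ∀ {V : Set} {m n} → Fin m ↣ V → Fin n ↣ V → Set
Disjoint X Y = ∀ x y → Injection.to X x ≢ Injection.to Y y

-- Nonemptiness is irrelevant so that an explanation is determined by its
-- two sets.
record Explanation (i c : ℕ) : Set where
  constructor _⇒_[_]
  field
    E         : Subset i
    M         : Subset c
    .nonempty : Nonempty M

ConsequentialMonotony : ∀ {i c} → Pred (Explanation i c) 0ℓ → Set
ConsequentialMonotony S =
  ∀ {E M M′} .(ne : Nonempty M) .(ne′ : Nonempty M′) →
  M′ Sub.⊆ M → (E ⇒ M [ ne ]) ∈ S → (E ⇒ M′ [ ne′ ]) ∈ S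

module _ {V : Set} {i c : ℕ} (I : Fin i ↣ V) (C : Fin c ↣ V) where

  Supported : DefaultTheory V → Explanation i c → Set₁
  Supported ⟨ D , W ⟩ (E ⇒ M [ _ ]) =
    ∃[ Θ ] (Extension ⟨ D , W ∪ literals I E ⟩ Θ ×
            Consistent Θ ×
            (∀ {φ} → φ ∈ literals C M → Θ ⊢ φ))

  SupportsExactly : DefaultTheory V → Pred (Explanation i c) 0ℓ → Set₁
  SupportsExactly Δ S = ∀ e → e ∈ S ⇔ Supported Δ e

{-# OPTIONS --safe #-}
module Submission where

-- The idea: a default can carry a complete description of I and C.  For a
-- monotone S take W empty and, for each E ⇒ M in S, the default
--
--     (conjunction of E) : state E M / state E M
--
-- where state E M says that precisely the variables of E and M are true
-- among those of I and C.
--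
-- If E ⇒ M is in S, then the consequences of state E M form a consistent
-- extension for E: any two different states exclude each other, so only the
-- default of E ⇒ M itself is unblocked (state-extension).
--
-- Conversely, let Θ be a consistent extension for E that contains M.  In the
-- world where only E is true, the nonempty M is false because I and C are
-- disjoint, so the derivation of M from E uses a default.  The prerequisite of the
-- first default used, coming from some E′ ⇒ M′ in S, holds in that world,
-- hence E′ ⊆ E; its justification is consistent with E, hence E ⊆ E′.  So
-- E ⇒ M′ is in S and state E M′ is in Θ (default-used).  As Θ is consistent,
-- M ⊆ M′, and monotony gives E ⇒ M.
--
-- That every default theory supports a monotone set is immediate, with the
-- same extension as witness.

import Data.Bool as Bool
open import Data.Bool using (Bool; true; false; not; _∧_; if_then_else_)
open import Data.Bool.Properties using (¬-not; not-¬; not-involutive; ∧-conicalˡ; ∧-conicalʳ)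
open import Data.Empty using (⊥-elim-irr)
open import Data.Fin using (Fin; zero; suc)
open import Data.Fin.Properties using (any?)
import Data.Fin.Subset as Sub
open import Data.Fin.Subset using (Subset; Nonempty)
open import Data.Fin.Subset.Properties using (_∈?_; ∉⊥; ⊆-antisym)
import Data.List as List
open import Data.List using ([]; _∷_)
open import Data.List.Relation.Unary.All as All using (All; []; _∷_)
import Data.List.Relation.Unary.All.Properties as All
open import Data.Nat using (ℕ; zero; suc)
open import Data.Product using (∃-syntax; _×_; _,_)
open import Data.Sum using (_⊎_; inj₁; inj₂; map₁)
open import Data.Vec using (lookup; tabulate)
open import Data.Vec.Properties
  using ([]=⇒lookup; lookup⇒[]=; lookup∘tabulate; tabulate∘lookup; tabulate-cong; ≡-dec)
open import Function using (_∘_)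
open import Function.Bundles using (_↣_; _⇔_; mk⇔; module Equivalence; module Injection)
open import Level using (0ℓ)
open import Relation.Binary.Definitions using (DecidableEquality)
open import Relation.Binary.PropositionalEquality
  using (_≡_; refl; sym; trans; cong; cong₂; subst)
open import Relation.Nullary using (¬_; yes; no; contradiction)
open import Relation.Nullary.Decidable using (decidable-stable)
open import Relation.Unary using (Pred; _∈_; _∉_; _⊆_; _∪_; ∅)
open import Defs

private variable
  V   : Set
  n   : ℕ
  φ ψ : Formula V
  T   : Pred (Formula V) 0ℓ

-- Deduction

-- The formula is true under the valuation.
Models : (V → Bool) → Formula V → Set
Models v φ = eval v φ ≡ true

~-intro : ∀ (v : V → Bool) φ → ¬ Models v φ → Models v (~ φ)
~-intro v φ ¬p = cong not (¬-not ¬p)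

~-elim : ∀ (v : V → Bool) φ → Models v (~ φ) → eval v φ ≡ false
~-elim v φ p = trans (sym (not-involutive _)) (cong not p)

weaken : DeductivelyClosed T → φ ∈ T → (∀ v → Models v φ → Models v ψ) → ψ ∈ T
weaken closed p φ⊨ψ = closed (_ ∷ [] , p ∷ [] , λ { v (q ∷ []) → φ⊨ψ v q })

-- The consequences of a single formula.
Th : Formula V → Pred (Formula V) 0ℓ
Th φ ψ = ∀ v → Models v φ → Models v ψ

Th-closed : DeductivelyClosed (Th φ)
Th-closed (_ , ps , Φ⊨ψ) v q = Φ⊨ψ v (All.map (λ p → p v q) ps)

-- Conjunctions describing the values of finitely many variables

⋀ : (Fin n → Formula V) → Formula V
⋀ {zero}  f = ⊤ᶠ
⋀ {suc _} f = f zero ∧ᶠ ⋀ (f ∘ suc)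

⋀-intro : ∀ (v : V → Bool) (f : Fin n → Formula V) →
          (∀ x → Models v (f x)) → Models v (⋀ f)
⋀-intro {n = zero}  v f ps = refl
⋀-intro {n = suc _} v f ps = cong₂ _∧_ (ps zero) (⋀-intro v (f ∘ suc) (ps ∘ suc))

⋀-elim : ∀ (v : V → Bool) (f : Fin n → Formula V) →
         Models v (⋀ f) → ∀ x → Models v (f x)
⋀-elim v f p zero    = ∧-conicalˡ _ _ p
⋀-elim v f p (suc x) = ⋀-elim v (f ∘ suc) (∧-conicalʳ (eval v (f zero)) _ p) x

⋀-deduce : DeductivelyClosed T → (f : Fin n → Formula _) → (∀ x → f x ∈ T) → ⋀ f ∈ T
⋀-deduce closed f ps =
  closed (List.tabulate f , All.tabulate⁺ ps , λ v qs → ⋀-intro v f (All.tabulate⁻ qs))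

module _ {V : Set} (X : Fin n ↣ V) where
  open Injection X using (to)

  -- The conjunct of x in positive P: trivial when x is outside P.
  member : Subset n → Fin n → Formula V
  member P x = if lookup P x then var (to x) else ⊤ᶠ

  -- The variables of P are true; the others are unconstrained.
  positive : Subset n → Formula V
  positive P = ⋀ (member P)

  positive-elim : ∀ v P → Models v (positive P) → ∀ {x} → x Sub.∈ P → v (to x) ≡ true
  positive-elim v P p {x} x∈P =
    trans (cong (λ b → eval v (if b then var (to x) else ⊤ᶠ)) (sym ([]=⇒lookup x∈P)))
          (⋀-elim v (member P) p x)

  positive-deduce : ∀ {P} → DeductivelyClosed T →
                    (∀ {x} → x Sub.∈ P → var (to x) ∈ T) → positive P ∈ T
  positive-deduce {T} {P} closed ps = ⋀-deduce closed (member P) go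
    where
    go : ∀ x → member P x ∈ T
    go x with lookup P x in eq
    ... | true  = ps (lookup⇒[]= x P eq)
    ... | false = closed ([] , [] , λ _ _ → refl)

  -- The variables with index in P are true and those with index outside P
  -- are false.
  exactly : Subset n → Formula V
  exactly P = ⋀ λ x → if lookup P x then var (to x) else (~ var (to x))

  -- The set of variables of X that are true in v.
  trueSet : (V → Bool) → Subset n
  trueSet v = tabulate (v ∘ to)

  exactly-intro : ∀ v {P} → trueSet v ≡ P → Models v (exactly P)
  exactly-intro v refl = ⋀-intro v _ go
    where
    go : ∀ x → Models v (if lookup (trueSet v) x then var (to x) else (~ var (to x)))
    go x rewrite lookup∘tabulate (v ∘ to) x with v (to x) in eq
    ... | true  = eq
    ... | false = cong not eq

  exactly-elim : ∀ v {P} → Models v (exactly P) → trueSet v ≡ P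
  exactly-elim v {P} p = trans (tabulate-cong go) (tabulate∘lookup P)
    where
    go : ∀ x → v (to x) ≡ lookup P x
    go x with lookup P x | ⋀-elim v (λ x → if lookup P x then var (to x) else (~ var (to x))) p x
    ... | true  | q = q
    ... | false | q = ~-elim v (var (to x)) q

  ∈-trueSet⁺ : ∀ v {x} → v (to x) ≡ true → x Sub.∈ trueSet v
  ∈-trueSet⁺ v {x} p = lookup⇒[]= x _ (trans (lookup∘tabulate (v ∘ to) x) p)

  ∈-trueSet⁻ : ∀ v {x} → x Sub.∈ trueSet v → v (to x) ≡ true
  ∈-trueSet⁻ v {x} p = trans (sym (lookup∘tabulate (v ∘ to) x)) ([]=⇒lookup p)

-- States and worlds

module _ {V : Set} {i c : ℕ} (I : Fin i ↣ V) (C : Fin c ↣ V) where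

  -- The complete description of the variables in I and C.
  state : Subset i → Subset c → Formula V
  state E M = exactly I E ∧ᶠ exactly C M

  state-intro : ∀ v {E M} → trueSet I v ≡ E → trueSet C v ≡ M → Models v (state E M)
  state-intro v p q = cong₂ _∧_ (exactly-intro I v p) (exactly-intro C v q)

  state-elimᴵ : ∀ v E M → Models v (state E M) → trueSet I v ≡ E
  state-elimᴵ v E M p = exactly-elim I v (∧-conicalˡ _ _ p)

  state-elimᶜ : ∀ v E M → Models v (state E M) → trueSet C v ≡ M
  state-elimᶜ v E M p = exactly-elim C v (∧-conicalʳ (eval v (exactly I E)) _ p)

module Worlds {V : Set} (_≟_ : DecidableEquality V)
              {i c : ℕ} (I : Fin i ↣ V) (C : Fin c ↣ V) (I#C : Disjoint I C) where
  private
    module I = Injection I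
    module C = Injection C

  -- The valuation in which only the variables of E and M are true.
  world : Subset i → Subset c → V → Bool
  world E M p with any? (λ x → I.to x ≟ p) | any? (λ y → C.to y ≟ p)
  ... | yes (x , _) | _           = lookup E x
  ... | no _        | yes (y , _) = lookup M y
  ... | no _        | no _        = false

  world-I : ∀ E M x → world E M (I.to x) ≡ lookup E x
  world-I E M x with any? (λ x′ → I.to x′ ≟ I.to x) | any? (λ y → C.to y ≟ I.to x)
  ... | yes (_ , eq) | _ = cong (lookup E) (I.injective eq)
  ... | no ¬p        | _ = contradiction (x , refl) ¬p

  world-C : ∀ E M y → world E M (C.to y) ≡ lookup M y
  world-C E M y with any? (λ x → I.to x ≟ C.to y) | any? (λ y′ → C.to y′ ≟ C.to y)
  ... | yes (x , eq) | _            = contradiction eq (I#C x y)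
  ... | no _         | yes (_ , eq) = cong (lookup M) (C.injective eq)
  ... | no _         | no ¬p        = contradiction (y , refl) ¬p

  trueSet-I : ∀ E M → trueSet I (world E M) ≡ E
  trueSet-I E M = trans (tabulate-cong (world-I E M)) (tabulate∘lookup E)

  trueSet-C : ∀ E M → trueSet C (world E M) ≡ M
  trueSet-C E M = trans (tabulate-cong (world-C E M)) (tabulate∘lookup M)

  state-consistent : ∀ E M → Consistent (Th (state I C E M))
  state-consistent E M ⊢⊥ with Th-closed {φ = state I C E M} {⊥ᶠ} ⊢⊥ (world E M)
                                (state-intro I C (world E M) (trueSet-I E M) (trueSet-C E M))
  ... | ()

-- The default theory of a set of explanations

module _ {V : Set} {i c : ℕ} (I : Fin i ↣ V) (C : Fin c ↣ V)
         (S : Pred (Explanation i c) 0ℓ) where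
  private
    module I = Injection I
    module C = Injection C

  -- For each E ⇒ M in S, the default concluding state E M from E.  Using
  -- state E M as justification too makes the defaults mutually exclusive;
  -- the prerequisite E prevents the default from firing for hypotheses that
  -- are smaller than E.
  data StateDefault : Pred (Default V) 0ℓ where
    stateDefault : ∀ {E M} .(ne : Nonempty M) → (E ⇒ M [ ne ]) ∈ S →
                   StateDefault (positive I E ∶ state I C E M / state I C E M)

  -- The default theory that supports exactly S when S is monotone.
  theory : DefaultTheory V
  theory = ⟨ StateDefault , ∅ ⟩

  -- The same theory with the hypotheses E added to the axioms.
  theoryWith : Subset i → DefaultTheory V
  theoryWith E = ⟨ StateDefault , ∅ ∪ literals I E ⟩

  positive∈Γ : ∀ E {Θ} → positive I E ∈ Γ (theoryWith E) Θ
  positive∈Γ E = positive-deduce I deduce λ x∈E → axiom (inj₂ (_ , x∈E , refl))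

  -- A state that is not refuted by Th (state E M) is state E M.
  compatible : ∀ {E M E′ M′} → (~ state I C E′ M′) ∉ Th (state I C E M) →
               (E ≡ E′) × (M ≡ M′)
  compatible {E} {M} {E′} {M′} ¬refuted =
    decidable-stable (≡-dec Bool._≟_ E E′)
      (λ E≢E′ → ¬refuted λ v p → ~-intro v (state I C E′ M′) λ q →
        E≢E′ (trans (sym (state-elimᴵ I C v E M p)) (state-elimᴵ I C v E′ M′ q))) ,
    decidable-stable (≡-dec Bool._≟_ M M′)
      (λ M≢M′ → ¬refuted λ v p → ~-intro v (state I C E′ M′) λ q →
        M≢M′ (trans (sym (state-elimᶜ I C v E M p)) (state-elimᶜ I C v E′ M′ q)))

  -- The default of E ⇒ M, if there is one, has its consequent in
  -- Th (state E M); all other defaults are blocked.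
  state-closed : ∀ E M → Closed (theoryWith E) (Th (state I C E M)) (Th (state I C E M))
  state-closed E M = record
    { contains-W      = λ { (inj₂ (x , x∈E , refl)) v p →
                            ∈-trueSet⁻ I v (subst (x Sub.∈_) (sym (state-elimᴵ I C v E M p)) x∈E) }
    ; deductive       = λ {φ} → Th-closed {φ = state I C E M} {φ}
    ; closed-defaults = λ { (stateDefault {E′} {M′} _ _) _ ¬refuted →
                            unblocked (compatible {E} {M} {E′} {M′} ¬refuted) }
    }
    where
    unblocked : ∀ {E′ M′} → (E ≡ E′) × (M ≡ M′) → state I C E′ M′ ∈ Th (state I C E M)
    unblocked (refl , refl) v p = p

  state-extension : ∀ {E M} .(ne : Nonempty M) → (E ⇒ M [ ne ]) ∈ S →
                    Consistent (Th (state I C E M)) →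
                    Extension (theoryWith E) (Th (state I C E M))
  state-extension {E} {M} ne e∈S consistent =
    (λ p → weaken deduce (apply (stateDefault ne e∈S) (positive∈Γ E) ¬refuted) p) ,
    Γ-least (state-closed E M)
    where
    ¬refuted : (~ state I C E M) ∉ Th (state I C E M)
    ¬refuted q = consistent
      ( ⊥ᶠ ∷ []
      , (λ v p → contradiction (~-elim v (state I C E M) (q v p)) (not-¬ p)) ∷ []
      , λ { v (p ∷ []) → p } )

  state⊢M : ∀ E M → literals C M ⊆ Th (state I C E M)
  state⊢M E M (y , y∈M , refl) v p =
    ∈-trueSet⁻ C v (subst (y Sub.∈_) (sym (state-elimᶜ I C v E M p)) y∈M)

  module _ (_≟_ : DecidableEquality V) (I#C : Disjoint I C)
           (E : Subset i) (Θ : Pred (Formula V) 0ℓ) (ext : Extension (theoryWith E) Θ) where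
    open Worlds _≟_ I C I#C

    private
      Γ⊆Θ : Γ (theoryWith E) Θ ⊆ Θ
      Γ⊆Θ = let _ , q = ext in q

      Θ⊆Γ : Θ ⊆ Γ (theoryWith E) Θ
      Θ⊆Γ = let p , _ = ext in p

      -- The world in which only the hypotheses E are true.
      E-alone : V → Bool
      E-alone = world E Sub.⊥

    -- The default of some explanation E ⇒ M in S has been applied in Θ.
    data Fired : Set where
      fired : ∀ {M} .(ne : Nonempty M) → (E ⇒ M [ ne ]) ∈ S → state I C E M ∈ Θ → Fired

    -- A default whose prerequisite holds in E-alone, and whose justification
    -- is consistent with Θ, belongs to E.
    same-E : ∀ {E′ M′} → Models E-alone (positive I E′) → (~ state I C E′ M′) ∉ Θ → E ≡ E′
    same-E {E′} {M′} prereq ¬refuted = ⊆-antisym E⊆E′ E′⊆E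
      where
      E⊆E′ : E Sub.⊆ E′
      E⊆E′ {x} x∈E = decidable-stable (x ∈? E′) λ x∉E′ →
        ¬refuted (Γ⊆Θ (weaken deduce (axiom (inj₂ (x , x∈E , refl))) λ v p →
          ~-intro v (state I C E′ M′) λ q →
            x∉E′ (subst (x Sub.∈_) (state-elimᴵ I C v E′ M′ q) (∈-trueSet⁺ I v p))))

      E′⊆E : E′ Sub.⊆ E
      E′⊆E x∈E′ = subst (_ Sub.∈_) (trueSet-I E Sub.⊥)
        (∈-trueSet⁺ I E-alone (positive-elim I E-alone E′ prereq x∈E′))

    -- What holds in E-alone, or anything once a default has fired, is a set
    -- of formulae with the closure properties of Γ, so by leastness of Γ a
    -- formula that is false in E-alone is derived only by firing a default.
    aloneOrFired-closed : Closed (theoryWith E) Θ (λ φ → Models E-alone φ ⊎ Fired)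
    aloneOrFired-closed = record
      { contains-W      = λ { (inj₂ (x , x∈E , refl)) →
                              inj₁ (trans (world-I E Sub.⊥ x) ([]=⇒lookup x∈E)) }
      ; deductive       = λ { (Φ , ps , Φ⊨φ) → map₁ (Φ⊨φ E-alone) (all⊎ ps) }
      ; closed-defaults = closed-defaults
      }
      where
      all⊎ : ∀ {Φ} → All (λ φ → Models E-alone φ ⊎ Fired) Φ → All (Models E-alone) Φ ⊎ Fired
      all⊎ []            = inj₁ []
      all⊎ (inj₂ f ∷ _)  = inj₂ f
      all⊎ (inj₁ p ∷ ps) = map₁ (p ∷_) (all⊎ ps)

      closed-defaults : ∀ {A B Q} → (A ∶ B / Q) ∈ StateDefault →
                        Models E-alone A ⊎ Fired → (~ B) ∉ Θ → Models E-alone Q ⊎ Fired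
      closed-defaults _ (inj₂ f) _ = inj₂ f
      closed-defaults (stateDefault {E′} {M′} ne e∈S) (inj₁ prereq) ¬refuted
        with refl ← same-E {E′} {M′} prereq ¬refuted =
        inj₂ (fired ne e∈S (Γ⊆Θ (apply (stateDefault ne e∈S) (positive∈Γ E) ¬refuted)))

    Θ-closed : DeductivelyClosed Θ
    Θ-closed (Φ , ps , Φ⊨φ) = Γ⊆Θ (deduce (Φ , All.map Θ⊆Γ ps , Φ⊨φ))

    -- M is nonempty and consists of variables that are false in E-alone.
    -- The evidence of nonemptiness is irrelevant, so it can serve only to
    -- reach absurdity.
    default-used : ∀ {M} .(ne : Nonempty M) → positive C M ∈ Θ → Fired
    default-used {M} ne p with Γ-least aloneOrFired-closed (Θ⊆Γ p)
    ... | inj₂ f = f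
    ... | inj₁ q = ⊥-elim-irr (none ne)
      where
      none : ¬ Nonempty M
      none (y , y∈M) = ∉⊥ (subst (y Sub.∈_) (trueSet-C E Sub.⊥)
                                 (∈-trueSet⁺ C E-alone (positive-elim C E-alone M q y∈M)))

    supported⇒∈ : ConsequentialMonotony S → Consistent Θ → ∀ {M} .(ne : Nonempty M) →
                  (∀ {φ} → φ ∈ literals C M → Θ ⊢ φ) → (E ⇒ M [ ne ]) ∈ S
    supported⇒∈ mono consistent {M} ne Θ⊢M
      with default-used ne (positive-deduce C Θ-closed λ y∈M → Θ-closed (Θ⊢M (_ , y∈M , refl)))
    ... | fired {M′} ne′ e∈S state∈Θ = mono ne′ ne M⊆M′ e∈S
      where
      M⊆M′ : M Sub.⊆ M′
      M⊆M′ {y} y∈M = decidable-stable (y ∈? M′) λ y∉M′ → consistent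
        ( state I C E M′ ∷ var (C.to y) ∷ []
        , state∈Θ ∷ Θ-closed (Θ⊢M (y , y∈M , refl)) ∷ []
        , λ { v (p ∷ q ∷ []) → contradiction
                (subst (y Sub.∈_) (state-elimᶜ I C v E M′ p) (∈-trueSet⁺ C v q)) y∉M′ } )

-- Monotony of supported sets, and the equivalence

theorem9 : {V : Set} → DecidableEquality V →
    ∀ {i c : ℕ} (I : Fin i ↣ V) (C : Fin c ↣ V) → Disjoint I C →
    (S : Pred (Explanation i c) 0ℓ) →
    ConsequentialMonotony S ⇔ (∃[ Δ ] SupportsExactly I C Δ S)
theorem9 _≟_ {i} {c} I C I#C S = mk⇔ construct monotone
  where
  open Worlds _≟_ I C I#C

  construct : ConsequentialMonotony S → ∃[ Δ ] SupportsExactly I C Δ S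
  construct mono = theory I C S , λ { (E ⇒ M [ ne ]) → mk⇔
    (λ e∈S → Th (state I C E M)
           , state-extension I C S ne e∈S (state-consistent E M)
           , state-consistent E M
           , λ {φ} φ∈M → φ ∷ [] , state⊢M I C S E M φ∈M ∷ [] , λ { v (p ∷ []) → p })
    (λ { (Θ , ext , consistent , Θ⊢M) →
         supported⇒∈ I C S _≟_ I#C E Θ ext mono consistent ne Θ⊢M }) }

  -- An extension containing M contains each subset of M.
  monotone : ∃[ Δ ] SupportsExactly I C Δ S → ConsequentialMonotony S
  monotone (Δ , supports) ne ne′ M′⊆M e∈S
    with Θ , ext , consistent , Θ⊢M ← Equivalence.to (supports _) e∈S =
    Equivalence.from (supports _)
      (Θ , ext , consistent , λ { (y , y∈M′ , eq) → Θ⊢M (y , M′⊆M y∈M′ , eq) })
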